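{- There is an infinite family of graphs $G$ of boxicity $2$ and bandwidth $O(1)$ such that, for any two interval graphs $I_1,I_2$ on vertex set $V(G)$ with $E(G)=E(I_1)\cap E(I_2)$, at least one of $I_1,I_2$ has treewidth $\Omega(|V(G)|)$.
   Context: A graph has boxicity at most $d$ iff it is the intersection (same vertex set, intersection of edge sets) of $d$ interval graphs; the boxicity is the least such $d$. An interval graph is the intersection graph of a finite family of closed real intervals. The bandwidth of $G$ is the least $k$ such that the vertices of $G$ can be assigned distinct integers $\ell(v)$ with $|\ell(u)-\ell(v)|\le k$ for every edge $uv$. The treewidth of $G$ is the minimum, over all chordal supergraphs $H$ of $G$ on the same vertex set, of the clique number of $H$ minus one. -}

module Defs where

open import Data.Nat using (ℕ; zero; suc; _+_; _*_; _≤_; ∣_-_∣)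
open import Data.Fin using (Fin; toℕ)
open import Data.Product using (Σ; ∃; ∃-syntax; _×_; _,_)
open import Data.Sum using (_⊎_)
open import Data.Empty using (⊥)
open import Relation.Nullary using (¬_)
open import Relation.Binary.PropositionalEquality using (_≡_; _≢_)
open import Function.Bundles using (_⇔_)
open import Function.Definitions using (Injective)

record Graph (n : ℕ) : Set₁ where
  field
    Adj    : Fin n → Fin n → Set
    sym    : ∀ {u v} → Adj u v → Adj v u
    irrefl : ∀ {v} → ¬ Adj v v
open Graph public

-- Interval graph: intersection graph of closed intervals [l v , r v].
-- (Endpoints in ℕ: for finite families this loses no generality.)
IsInterval : ∀ {n} → Graph n → Set
IsInterval {n} G =
  Σ (Fin n → ℕ) λ l → Σ (Fin n → ℕ) λ r →
    (∀ v → l v ≤ r v) ×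
    (∀ u v → u ≢ v → (Adj G u v ⇔ (l u ≤ r v × l v ≤ r u)))

IsIntersectionOf : ∀ {n d} → Graph n → (Fin d → Graph n) → Set
IsIntersectionOf {n} {d} G Is =
  ∀ u v → u ≢ v → (Adj G u v ⇔ (∀ (i : Fin d) → Adj (Is i) u v))

BoxicityAtMost : ∀ {n} → Graph n → ℕ → Set₁
BoxicityAtMost {n} G d =
  Σ (Fin d → Graph n) λ Is → (∀ i → IsInterval (Is i)) × IsIntersectionOf G Is

BoxicityEq : ∀ {n} → Graph n → ℕ → Set₁
BoxicityEq G d = BoxicityAtMost G d × (∀ e → BoxicityAtMost G e → d ≤ e)

BandwidthAtMost : ∀ {n} → Graph n → ℕ → Set
BandwidthAtMost {n} G b =
  Σ (Fin n → ℕ) λ ℓ → Injective _≡_ _≡_ ℓ ×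
    (∀ u v → Adj G u v → ∣ ℓ u - ℓ v ∣ ≤ b)

CycSucc : (k : ℕ) → Fin k → Fin k → Set
CycSucc k i j = (toℕ j ≡ suc (toℕ i)) ⊎ (toℕ j ≡ 0 × suc (toℕ i) ≡ k)

IsCycle : ∀ {n} → Graph n → (k : ℕ) → (Fin k → Fin n) → Set
IsCycle G k c = Injective _≡_ _≡_ c × (∀ i j → CycSucc k i j → Adj G (c i) (c j))

HasChord : ∀ {n} → Graph n → (k : ℕ) → (Fin k → Fin n) → Set
HasChord G k c =
  ∃[ i ] ∃[ j ] (i ≢ j × ¬ CycSucc k i j × ¬ CycSucc k j i × Adj G (c i) (c j))

Chordal : ∀ {n} → Graph n → Set
Chordal {n} G = ∀ k → 4 ≤ k → (c : Fin k → Fin n) → IsCycle G k c → HasChord G k c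

HasClique : ∀ {n} → Graph n → ℕ → Set
HasClique {n} G s =
  Σ (Fin s → Fin n) λ f → Injective _≡_ _≡_ f × (∀ i j → i ≢ j → Adj G (f i) (f j))

Supergraph : ∀ {n} → Graph n → Graph n → Set
Supergraph G H = ∀ u v → Adj G u v → Adj H u v

-- treewidth G ≥ t : every chordal supergraph H has clique number ≥ t + 1
-- (treewidth = min over chordal supergraphs H of ω(H) − 1)
TreewidthAtLeast : ∀ {n} → Graph n → ℕ → Set₁
TreewidthAtLeast {n} G t =
  (H : Graph n) → Supergraph G H → Chordal H → HasClique H (suc t)

{-# OPTIONS --safe #-}
module Submission where

-- The graphs are the strong products C₄ ⊠ P, drawn as concentric square frames
-- aᵢ bᵢ cᵢ dᵢ (left, bottom, right, top) in which frames with consecutive indices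
-- touch. An interval graph induces no C₄, so in any representation by two interval
-- graphs, one of them separates aᵢ from cᵢ and the other bᵢ from dᵢ; overlaps between
-- consecutive frames make this choice, and the left-right and bottom-top orders, the
-- same for all i. Then aⱼ and aⱼ₊₂ are separated horizontally, in a direction that
-- does not depend on j. If a moves inward, then bⱼ and aⱼ₊₂ overlap horizontally, so,
-- being nonadjacent, they are separated vertically, which forces b to move inward;
-- rotating, all four sides move inward together. Hence the gaps between aᵢ and cᵢ are
-- nested along even i, and every bᵢ with i even spans the innermost gap: these
-- vertices form a clique in one interval graph.

open import Defs
open import Data.Bool using (Bool; true; false; not)
open import Data.Empty using (⊥-elim)
open import Data.Fin as Fin using (Fin; toℕ; combine; quotient; remainder; opposite)
open import Data.Fin.Patterns using (0F; 1F; 2F; 3F)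
open import Data.Fin.Properties using (remQuot-combine; combine-remQuot; toℕ-combine; toℕ-fromℕ<; toℕ-injective; toℕ<n; toℕ≤pred[n]; opposite-involutive)
open import Data.Nat using (ℕ; zero; suc; _+_; _*_; _∸_; _≤_; _<_; ∣_-_∣; z≤n; s≤s; _≤′_; ≤′-refl; ≤′-step)
open import Data.Nat.DivMod using (_%_; _mod_; m≤n⇒m%n≡m)
open import Data.Nat.Properties
open import Data.Product as Product using (Σ; ∃; ∃-syntax; _×_; _,_; proj₁; proj₂)
open import Data.Sum as Sum using (_⊎_; inj₁; inj₂; [_,_]′)
open import Function.Base using (_∘_; id)
open import Function.Bundles using (_⇔_; Equivalence; mk⇔)
open import Relation.Nullary using (¬_; yes; no; contradiction)
open import Relation.Binary.PropositionalEquality as ≡ using (_≡_; _≢_; refl; cong; subst₂)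

-- Interval orders

-- Fishburn's axioms, with `ferrers` excluding the poset 2+2. Working without endpoints lets
-- reversal act as a symmetry.
record IntervalOrder (V : Set) : Set₁ where
  infix 4 _≪_
  field
    _≪_      : V → V → Set
    ≪-irrefl : ∀ {u} → ¬ u ≪ u
    ferrers  : ∀ {u v w z} → u ≪ v → w ≪ z → u ≪ z ⊎ w ≪ v

  Separated : V → V → Set
  Separated u v = u ≪ v ⊎ v ≪ u

  Overlapping : V → V → Set
  Overlapping u v = ¬ u ≪ v × ¬ v ≪ u

  ≪-trans : ∀ {u v w} → u ≪ v → v ≪ w → u ≪ w
  ≪-trans u≪v v≪w = [ id , ⊥-elim ∘ ≪-irrefl ]′ (ferrers u≪v v≪w)

  -- If instead `w ≪ u′`, transitivity would give `u ≪ u′`. This passes a separation on to an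
  -- interval that touches `u`.
  ≪-extendˡ : ∀ {u u′ w} → ¬ u ≪ u′ → Separated u′ w → u ≪ w → u′ ≪ w
  ≪-extendˡ u≪̸u′ (inj₁ u′≪w) u≪w = u′≪w
  ≪-extendˡ u≪̸u′ (inj₂ w≪u′) u≪w = contradiction (≪-trans u≪w w≪u′) u≪̸u′

  ≪-extendʳ : ∀ {u w w′} → ¬ w′ ≪ w → Separated u w′ → u ≪ w → u ≪ w′
  ≪-extendʳ w′≪̸w (inj₁ u≪w′) u≪w = u≪w′
  ≪-extendʳ w′≪̸w (inj₂ w′≪u) u≪w = contradiction (≪-trans w′≪u u≪w) w′≪̸w

  -- `u` ends no earlier than `d` starts, `w` starts no later than `b` ends, and the end of `b`
  -- precedes the start of `d`.
  common-gap : ∀ {b d u w} → b ≪ d → ¬ u ≪ d → ¬ b ≪ w → ¬ u ≪ w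
  common-gap b≪d u≪̸d b≪̸w u≪w = [ u≪̸d , b≪̸w ]′ (ferrers u≪w b≪d)

  -- No induced four-cycle: `b` and `d` would both span the gap between `a` and `c`, hence overlap.
  no-crossing-pairs : ∀ {a b c d} → Overlapping a b → Overlapping a d → Overlapping c b → Overlapping c d →
                      Separated a c → ¬ Separated b d
  no-crossing-pairs (ab , ba) (ad , da) (cb , bc) (cd , dc) (inj₁ a≪c) =
    [ common-gap a≪c bc ad , common-gap a≪c dc ab ]′
  no-crossing-pairs (ab , ba) (ad , da) (cb , bc) (cd , dc) (inj₂ c≪a) =
    [ common-gap c≪a ba cd , common-gap c≪a da cb ]′

  -- By `ferrers`, `u₃ ≪ u₁` and `u₀ ≪ u₂` would force `u₃ ≪ u₂` or `u₀ ≪ u₁`. For a sequence with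
  -- touching neighbours, all moves by two steps therefore go the same way.
  direction-persists : ∀ {u₀ u₁ u₂ u₃} → ¬ u₀ ≪ u₁ → ¬ u₃ ≪ u₂ → Separated u₁ u₃ →
                       u₀ ≪ u₂ → u₁ ≪ u₃
  direction-persists u₀≪̸u₁ u₃≪̸u₂ (inj₁ u₁≪u₃) u₀≪u₂ = u₁≪u₃
  direction-persists u₀≪̸u₁ u₃≪̸u₂ (inj₂ u₃≪u₁) u₀≪u₂ =
    ⊥-elim ([ u₃≪̸u₂ , u₀≪̸u₁ ]′ (ferrers u₃≪u₁ u₀≪u₂))

  ascend : ∀ {t z} (u : ℕ → V) → (∀ i → suc i ≤ t → u i ≪ u (suc i)) →
           ∀ {p q} → p ≤′ q → q ≤ t → u q ≪ z → u p ≪ z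
  ascend u step ≤′-refl       q≤t uq≪z = uq≪z
  ascend u step (≤′-step p≤q) q<t uq≪z =
    ascend u step p≤q (<⇒≤ q<t) (≪-trans (step _ q<t) uq≪z)

  descend : ∀ {t z} (u : ℕ → V) → (∀ i → suc i ≤ t → u (suc i) ≪ u i) →
            ∀ p → p ≤ t → u 0 ≪ z → u p ≪ z
  descend u step zero    p≤t u₀≪z = u₀≪z
  descend u step (suc p) p<t u₀≪z = ≪-trans (step p p<t) (descend u step p (<⇒≤ p<t) u₀≪z)

open IntervalOrder

reverse : ∀ {V} → IntervalOrder V → IntervalOrder V
reverse X ._≪_ u v       = _≪_ X v u
reverse X .≪-irrefl      = ≪-irrefl X
reverse X .ferrers v≪u z≪w = Sum.swap (ferrers X v≪u z≪w)

-- Concentric frames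

Near : ℕ → ℕ → Set
Near i j = i ≤ suc j × j ≤ suc i

near-refl : ∀ {i} → Near i i
near-refl = n≤1+n _ , n≤1+n _

near-suc : ∀ {i} → Near i (suc i)
near-suc = m≤n⇒m≤1+n (n≤1+n _) , ≤-refl

near-sym : ∀ {i j} → Near i j → Near j i
near-sym (p , q) = q , p

module _ {V : Set} (X Y : IntervalOrder V) where

  Meet : V → V → Set
  Meet u v = Overlapping X u v × Overlapping Y u v

  Apart : V → V → Set
  Apart u v = Separated X u v ⊎ Separated Y u v

-- v p s i is a side of the i-th frame: p is the axis and s tells the two
-- opposite sides on that axis apart.
record Frames {V : Set} (X Y : IntervalOrder V) (N : ℕ) (v : Bool → Bool → ℕ → V) : Set where
  field
    cross : ∀ p s t {i j} → i ≤ N → j ≤ N → Near i j → Meet X Y (v p s i) (v (not p) t j)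
    along : ∀ p s {i j} → i ≤ N → j ≤ N → Near i j → Meet X Y (v p s i) (v p s j)
    opp   : ∀ p s {i j} → i ≤ N → j ≤ N → Apart X Y (v p s i) (v p (not s) j)
    far   : ∀ p q s t {i} → 2 + i ≤ N → Apart X Y (v p s i) (v q t (2 + i))

open Frames

module _ {V : Set} {X Y : IntervalOrder V} {N : ℕ} {v : Bool → Bool → ℕ → V} where

  exchange-axes : Frames X Y N v → Frames X Y N (v ∘ not)
  exchange-axes F .cross p = cross F (not p)
  exchange-axes F .along p = along F (not p)
  exchange-axes F .opp p   = opp F (not p)
  exchange-axes F .far p q = far F (not p) (not q)

  exchange-orders : Frames X Y N v → Frames Y X N v
  exchange-orders F .cross p s t i≤N j≤N n = let x , y = cross F p s t i≤N j≤N n in y , x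
  exchange-orders F .along p s i≤N j≤N n   = let x , y = along F p s i≤N j≤N n in y , x
  exchange-orders F .opp p s i≤N j≤N       = Sum.swap (opp F p s i≤N j≤N)
  exchange-orders F .far p q s t 2+i≤N     = Sum.swap (far F p q s t 2+i≤N)

  reverse-first : Frames X Y N v → Frames (reverse X) Y N v
  reverse-first F .cross p s t i≤N j≤N n =
    let (x , x′) , y = cross F p s t i≤N j≤N n in (x′ , x) , y
  reverse-first F .along p s i≤N j≤N n   =
    let (x , x′) , y = along F p s i≤N j≤N n in (x′ , x) , y
  reverse-first F .opp p s i≤N j≤N       = Sum.map₁ Sum.swap (opp F p s i≤N j≤N)
  reverse-first F .far p q s t 2+i≤N     = Sum.map₁ Sum.swap (far F p q s t 2+i≤N)

-- Exchanging the sides of the second axis compensates for the reversed order in a quarter turn.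
mirror : Bool → Bool → Bool
mirror false s = s
mirror true  s = not s

module _ {V : Set} {X Y : IntervalOrder V} {N : ℕ} {v : Bool → Bool → ℕ → V} where

  reverse-second : Frames X Y N v → Frames X (reverse Y) N v
  reverse-second = exchange-orders ∘ reverse-first ∘ exchange-orders

  mirror-second : Frames X Y N v → Frames X Y N (λ p s → v p (mirror p s))
  mirror-second F .cross p s t = cross F p (mirror p s) (mirror (not p) t)
  mirror-second F .along p s   = along F p (mirror p s)
  mirror-second F .opp false s = opp F false s
  mirror-second F .opp true s  = opp F true (not s)
  mirror-second F .far p q s t = far F p q (mirror p s) (mirror q t)

-- Orientation of the frames and its propagation

record Oriented {V : Set} (X Y : IntervalOrder V) (N : ℕ) (v : Bool → Bool → ℕ → V) : Set where
  field
    frames : Frames X Y N v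
    first  : ∀ {i} → i ≤ N → _≪_ X (v false false i) (v false true i)
    second : ∀ {i} → i ≤ N → _≪_ Y (v true false i) (v true true i)

open Oriented

transpose : ∀ {V} {X Y : IntervalOrder V} {N v} → Oriented X Y N v → Oriented Y X N (v ∘ not)
transpose O .frames = exchange-orders (exchange-axes (frames O))
transpose O .first  = second O
transpose O .second = first O

-- The quarter turn taking a, b, c, d to b, c, d, a. In the reversed `X` the right side precedes the
-- left one, so both orientation facts carry over unchanged.
rotate : ∀ {V} {X Y : IntervalOrder V} {N v} → Oriented X Y N v →
         Oriented Y (reverse X) N (λ p s → v (not p) (mirror p s))
rotate O .frames = mirror-second (reverse-second (exchange-orders (exchange-axes (frames O))))
rotate O .first  = second O
rotate O .second = first O

module _ {V : Set} {X Y : IntervalOrder V} {N : ℕ} {v : Bool → Bool → ℕ → V}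
         (F : Frames X Y N v) where

  private
    a b c d : ℕ → V
    a = v false false
    b = v true false
    c = v false true
    d = v true true
    module X = IntervalOrder X
    module Y = IntervalOrder Y

  -- Both sides overlap `b j` and `d j` in `Y`, so they span the gap between these two and overlap
  -- in `Y`; only `X` can separate them.
  first-separated : ∀ s s′ {i i′ j} → i ≤ N → i′ ≤ N → j ≤ N → Near i j → Near i′ j →
                    b j Y.≪ d j → Apart X Y (v false s i) (v false s′ i′) →
                    X.Separated (v false s i) (v false s′ i′)
  first-separated s s′ i≤N i′≤N j≤N ij i′j b≪d (inj₁ sep) = sep
  first-separated s s′ i≤N i′≤N j≤N ij i′j b≪d (inj₂ sep) = ⊥-elim
    ([ Y.common-gap b≪d (proj₁ (below s true i≤N ij)) (proj₂ (below s′ false i′≤N i′j))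
     , Y.common-gap b≪d (proj₁ (below s′ true i′≤N i′j)) (proj₂ (below s false i≤N ij)) ]′ sep)
    where
    below : ∀ s t {i} → i ≤ N → Near i _ → Y.Overlapping (v false s i) (v true t _)
    below s t i≤N n = proj₂ (cross F false s t i≤N j≤N n)

  -- One end is moved at a time: `a i ≪ c i` gives `a (suc i) ≪ c i`, then `a (suc i) ≪ c (suc i)`.
  -- The gap of frame `i` in `Y` supplies the required separations in `X`.
  first-oriented-suc : ∀ {i} → suc i ≤ N → b i Y.≪ d i → a i X.≪ c i → a (suc i) X.≪ c (suc i)
  first-oriented-suc i<N b≪d a≪c =
    X.≪-extendʳ (proj₂ (proj₁ (along F false true i≤N i<N near-suc)))
      (first-separated false true i<N i<N i≤N near-pred near-pred b≪d (opp F false false i<N i<N))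
      (X.≪-extendˡ (proj₁ (proj₁ (along F false false i≤N i<N near-suc)))
        (first-separated false true i<N i≤N i≤N near-pred near-refl b≪d (opp F false false i<N i≤N))
        a≪c)
    where
    i≤N = <⇒≤ i<N
    near-pred = near-sym near-suc

  first-separated⇒second-unseparated : ∀ {j} → j ≤ N → X.Separated (a j) (c j) → ¬ X.Separated (b j) (d j)
  first-separated⇒second-unseparated j≤N =
    X.no-crossing-pairs (meet false false) (meet false true) (meet true false) (meet true true)
    where
    meet : ∀ s t → X.Overlapping (v false s _) (v true t _)
    meet s t = proj₁ (cross F false s t j≤N j≤N near-refl)

  first-separated⇒second-separated : ∀ {j} → j ≤ N → X.Separated (a j) (c j) → Y.Separated (b j) (d j)
  first-separated⇒second-separated j≤N sep with opp F true false j≤N j≤N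
  ... | inj₁ sep′ = contradiction sep′ (first-separated⇒second-unseparated j≤N sep)
  ... | inj₂ sep′ = sep′

-- The gap in each order propagates the direction in the other, so both facts go through one
-- induction.
orient : ∀ {V} {X Y : IntervalOrder V} {N v} → Frames X Y N v →
         _≪_ X (v false false 0) (v false true 0) → _≪_ Y (v true false 0) (v true true 0) →
         Oriented X Y N v
orient {X = X} {Y} {N} {v} F a≪c b≪d = record
  { frames = F ; first = λ {i} i≤N → proj₁ (both i i≤N) ; second = λ {i} i≤N → proj₂ (both i i≤N) }
  where
  both : ∀ i → i ≤ N → _≪_ X (v false false i) (v false true i) × _≪_ Y (v true false i) (v true true i)
  both zero    _   = a≪c , b≪d
  both (suc i) i<N with both i (<⇒≤ i<N)
  ... | a≪cᵢ , b≪dᵢ = first-oriented-suc F i<N b≪dᵢ a≪cᵢ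
                    , first-oriented-suc (exchange-orders (exchange-axes F)) i<N a≪cᵢ b≪dᵢ

module _ {V : Set} {X Y : IntervalOrder V} {N : ℕ} {v : Bool → Bool → ℕ → V}
         (O : Oriented X Y N v) where

  private
    F = frames O
    a c : ℕ → V
    a = v false false
    c = v false true
    module X = IntervalOrder X

  first-near : ∀ {i j} → i ≤ N → j ≤ N → Near i j → a i X.≪ c j
  first-near i≤N j≤N ij =
    X.≪-extendʳ (proj₂ (proj₁ (along F false true i≤N j≤N ij)))
      (first-separated F false true i≤N j≤N j≤N ij near-refl (second O j≤N)
        (opp F false false i≤N j≤N))
      (first O i≤N)

  -- Both sides touch frame `1 + j`, so they span its gap in `Y`.
  two-apart : ∀ s {j} → 2 + j ≤ N → X.Separated (v false s j) (v false s (2 + j))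
  two-apart s 2+j≤N =
    first-separated F s s (<⇒≤ 1+j≤N) 2+j≤N 1+j≤N near-suc (near-sym near-suc) (second O 1+j≤N)
      (far F false false s s 2+j≤N)
    where 1+j≤N = <⇒≤ 2+j≤N

-- Inward and outward motion of the sides

module _ {V : Set} {X Y : IntervalOrder V} {N : ℕ} {v : Bool → Bool → ℕ → V}
         (O : Oriented X Y N v) where

  private
    F = frames O
    a b : ℕ → V
    a = v false false
    b = v true false
    module X = IntervalOrder X
    module Y = IntervalOrder Y

  inward-first⇒second : ∀ {j} → 2 + j ≤ N → a j X.≪ a (2 + j) → b j Y.≪ b (2 + j)
  -- An outward move of `b` would put `b (2 + j)` before `b j`, hence before `a (2 + j)`, which it
  -- meets.
  inward-first⇒second {j} 2+j≤N a≪a = [ id , (λ b≪b → contradiction (Y.≪-trans b≪b b≪a) b₂≪̸a₂) ]′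
      (two-apart (transpose O) false 2+j≤N)
    where
    1+j≤N = <⇒≤ 2+j≤N
    j≤N = <⇒≤ 1+j≤N

    b₂≪̸a₂ : ¬ b (2 + j) Y.≪ a (2 + j)
    b₂≪̸a₂ = proj₁ (proj₂ (cross F true false false 2+j≤N 2+j≤N near-refl))

    b≪a : b j Y.≪ a (2 + j)
    -- Three of the four separations separate a meeting pair: `b j` from `c (1 + j)`, `a j` from
    -- `b j`, and `a (2 + j)` from `d (1 + j)`, respectively.
    b≪a with far F true false false false 2+j≤N
    ... | inj₁ (inj₁ b≪a₂) = contradiction
      (X.≪-trans b≪a₂ (first-near O 2+j≤N 1+j≤N (near-sym near-suc)))
      (proj₁ (proj₁ (cross F true false true j≤N 1+j≤N near-suc)))
    ... | inj₁ (inj₂ a₂≪b) = contradiction (X.≪-trans a≪a a₂≪b)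
      (proj₁ (proj₁ (cross F false false false j≤N j≤N near-refl)))
    ... | inj₂ (inj₁ b≪a₂) = b≪a₂
    ... | inj₂ (inj₂ a₂≪b) = contradiction
      (Y.≪-trans a₂≪b (first-near (transpose O) j≤N 1+j≤N near-suc))
      (proj₁ (proj₂ (cross F false false true 2+j≤N 1+j≤N (near-sym near-suc))))

module _ {V : Set} {X Y : IntervalOrder V} {t : ℕ} {v : Bool → Bool → ℕ → V}
         (O : Oriented X Y (t * 2) v) where

  private
    F = frames O
    a b c : ℕ → V
    a = v false false
    b = v true false
    c = v false true
    module X = IntervalOrder X
    module X⁻ = IntervalOrder (reverse X)

    -- The factor 2 stands on the right because `suc i * 2` reduces to `2 + i * 2`, the index shift
    -- in `far`.
    even : ∀ {i} → i ≤ t → i * 2 ≤ t * 2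
    even = *-monoˡ-≤ 2

    Inward Outward : Set
    Inward  = ∀ j → 2 + j ≤ t * 2 → a j X.≪ a (2 + j)
    Outward = ∀ j → 2 + j ≤ t * 2 → a (2 + j) X.≪ a j

  inward-or-outward : 2 ≤ t * 2 → Inward ⊎ Outward
  inward-or-outward 2≤N with two-apart O false 2≤N
  ... | inj₁ a₀≪a₂ = inj₁ inward
    where
    inward : Inward
    inward zero    _     = a₀≪a₂
    inward (suc j) 3+j≤N = X.direction-persists
      (proj₁ (proj₁ (along F false false (<⇒≤ (<⇒≤ (<⇒≤ 3+j≤N))) (<⇒≤ (<⇒≤ 3+j≤N)) near-suc)))
      (proj₁ (proj₁ (along F false false 3+j≤N (<⇒≤ 3+j≤N) (near-sym near-suc))))
      (two-apart O false 3+j≤N)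
      (inward j (<⇒≤ 3+j≤N))
  ... | inj₂ a₂≪a₀ = inj₂ outward
    where
    outward : Outward
    outward zero    _     = a₂≪a₀
    outward (suc j) 3+j≤N = X⁻.direction-persists
      (proj₂ (proj₁ (along F false false (<⇒≤ (<⇒≤ (<⇒≤ 3+j≤N))) (<⇒≤ (<⇒≤ 3+j≤N)) near-suc)))
      (proj₂ (proj₁ (along F false false 3+j≤N (<⇒≤ 3+j≤N) (near-sym near-suc))))
      (Sum.swap (two-apart O false 3+j≤N))
      (outward j (<⇒≤ 3+j≤N))

  -- Two quarter turns, through b; the next lemma returns from c through d.
  inward-a⇒c : ∀ {j} → 2 + j ≤ t * 2 → a j X.≪ a (2 + j) → c (2 + j) X.≪ c j
  inward-a⇒c 2+j≤N = inward-first⇒second (rotate O) 2+j≤N ∘ inward-first⇒second O 2+j≤N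

  inward-c⇒a : ∀ {j} → 2 + j ≤ t * 2 → c (2 + j) X.≪ c j → a j X.≪ a (2 + j)
  inward-c⇒a 2+j≤N = inward-first⇒second (rotate (rotate (rotate O))) 2+j≤N
                   ∘ inward-first⇒second (rotate (rotate O)) 2+j≤N

  -- Even frames are nested, so all their gaps contain the innermost one: that of frame `t * 2` if
  -- the sides move inward, that of frame 0 if they move outward.
  gaps-intersect : 2 ≤ t * 2 → ∀ {p q} → p ≤ t → q ≤ t → a (p * 2) X.≪ c (q * 2)
  gaps-intersect 2≤N {p} {q} p≤t q≤t with inward-or-outward 2≤N
  ... | inj₁ inward =
    X⁻.ascend (λ i → c (i * 2)) (λ i i<t → inward-a⇒c (even i<t) (inward _ (even i<t))) (≤⇒≤′ q≤t) ≤-refl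
      (X.ascend (λ i → a (i * 2)) (λ i i<t → inward _ (even i<t)) (≤⇒≤′ p≤t) ≤-refl
        (first O ≤-refl))
  ... | inj₂ outward =
    X⁻.descend (λ i → c (i * 2)) (λ i i<t → c-outward (even i<t)) q q≤t
      (X.descend (λ i → a (i * 2)) (λ i i<t → outward _ (even i<t)) p p≤t (first O z≤n))
    where
    c-outward : ∀ {j} → 2 + j ≤ t * 2 → c j X.≪ c (2 + j)
    c-outward 2+j≤N with two-apart O true 2+j≤N
    ... | inj₁ c≪c₂ = c≪c₂
    -- An inward move of `c` would force one of `a`.
    ... | inj₂ c₂≪c = ⊥-elim
      (X.≪-irrefl (X.≪-trans (inward-c⇒a 2+j≤N c₂≪c) (outward _ 2+j≤N)))

  -- `b (p * 2)` meets `c (p * 2)` and `b (q * 2)` meets `a (q * 2)`, and `a (q * 2)` lies before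
  -- `c (p * 2)`.
  second-overlap : 2 ≤ t * 2 → ∀ {p q} → p ≤ t → q ≤ t → X.Overlapping (b (p * 2)) (b (q * 2))
  second-overlap 2≤N p≤t q≤t = not-before p≤t q≤t , not-before q≤t p≤t
    where
    not-before : ∀ {p q} → p ≤ t → q ≤ t → ¬ b (p * 2) X.≪ b (q * 2)
    not-before p≤t q≤t = X.common-gap (gaps-intersect 2≤N q≤t p≤t)
      (proj₁ (proj₁ (cross F true false true (even p≤t) (even p≤t) near-refl)))
      (proj₁ (proj₁ (cross F false false false (even q≤t) (even q≤t) near-refl)))

module _ {V : Set} {X Y : IntervalOrder V} {t : ℕ} {v : Bool → Bool → ℕ → V} (1≤t : 1 ≤ t) where

  -- Reversing `X` or `Y` as needed reduces the four possible directions in frame 0 to one;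
  -- reversing `X` merely swaps the two halves of an overlap.
  overlap-if-first-separated : Frames X Y (t * 2) v →
    Separated X (v false false 0) (v false true 0) →
    ∀ {p q} → p ≤ t → q ≤ t → Overlapping X (v true false (p * 2)) (v true false (q * 2))
  overlap-if-first-separated F sep p≤t q≤t with first-separated⇒second-separated F z≤n sep
  overlap-if-first-separated F (inj₁ a≪c) p≤t q≤t | inj₁ b≪d =
    second-overlap (orient F a≪c b≪d) (*-monoˡ-≤ 2 1≤t) p≤t q≤t
  overlap-if-first-separated F (inj₁ a≪c) p≤t q≤t | inj₂ d≪b =
    second-overlap (orient (reverse-second F) a≪c d≪b) (*-monoˡ-≤ 2 1≤t) p≤t q≤t
  overlap-if-first-separated F (inj₂ c≪a) p≤t q≤t | inj₁ b≪d = Product.swap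
    (second-overlap (orient (reverse-first F) c≪a b≪d) (*-monoˡ-≤ 2 1≤t) p≤t q≤t)
  overlap-if-first-separated F (inj₂ c≪a) p≤t q≤t | inj₂ d≪b = Product.swap
    (second-overlap (orient (reverse-second (reverse-first F)) c≪a d≪b) (*-monoˡ-≤ 2 1≤t) p≤t q≤t)

-- The axis is the one whose sides in frame 0 are not separated by `X`; the overlaps thus always
-- occur in the first order.
some-axis-overlaps : ∀ {V} {X Y : IntervalOrder V} {t v} → 1 ≤ t → Frames X Y (t * 2) v →
  ∃[ p ] (∀ {i j} → i ≤ t → j ≤ t → Overlapping X (v p false (i * 2)) (v p false (j * 2)))
some-axis-overlaps 1≤t F with opp F false false z≤n z≤n
... | inj₁ sep = true , overlap-if-first-separated 1≤t F sep
... | inj₂ sep = false , overlap-if-first-separated 1≤t (exchange-axes F)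
                   (first-separated⇒second-separated (exchange-orders F) z≤n sep)

-- Interval representations of the strong product of C₄ and a path

order : ∀ {n} (I : Graph n) → IsInterval I → IntervalOrder (Fin n)
order I (l , r , l≤r , _) ._≪_ u v   = r u < l v
order I (l , r , l≤r , _) .≪-irrefl r<l = <⇒≱ r<l (l≤r _)
order I (l , r , l≤r , _) .ferrers {u} {v} {w} {z} u<v w<z with r u <? l z
... | yes u<z = inj₁ u<z
... | no  u≮z = inj₂ (<-≤-trans w<z (≤-trans (≮⇒≥ u≮z) (<⇒≤ u<v)))

module _ {n : ℕ} (I : Graph n) (iv : IsInterval I) where

  private
    l = proj₁ iv
    r = proj₁ (proj₂ iv)
    iff = proj₂ (proj₂ (proj₂ iv))

  adjacent⇒overlapping : ∀ {u v} → u ≢ v → Adj I u v → Overlapping (order I iv) u v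
  adjacent⇒overlapping u≢v uv = let p , q = Equivalence.to (iff _ _ u≢v) uv in ≤⇒≯ q , ≤⇒≯ p

  overlapping⇒adjacent : ∀ {u v} → u ≢ v → Overlapping (order I iv) u v → Adj I u v
  overlapping⇒adjacent u≢v (p , q) = Equivalence.from (iff _ _ u≢v) (≮⇒≥ q , ≮⇒≥ p)

  separated-or-overlapping : ∀ u v → Separated (order I iv) u v ⊎ Overlapping (order I iv) u v
  separated-or-overlapping u v with r u <? l v | r v <? l u
  ... | yes u<v | _       = inj₁ (inj₁ u<v)
  ... | no  _   | yes v<u = inj₁ (inj₂ v<u)
  ... | no  u≮v | no  v≮u = inj₂ (u≮v , v≮u)

-- On `Fin 4`, `opposite` pairs 0 with 3 and 1 with 2, so the four-cycle runs 0, 1, 3, 2.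
C₄⊠P : (N : ℕ) → Graph (suc N * 4)
C₄⊠P N .Adj u v = u ≢ v × Near (toℕ (quotient {suc N} 4 u)) (toℕ (quotient {suc N} 4 v))
                × remainder {suc N} 4 v ≢ opposite (remainder {suc N} 4 u)
C₄⊠P N .sym (u≢v , near , ¬opp) =
  u≢v ∘ ≡.sym , near-sym near ,
  λ eq → ¬opp (≡.trans (≡.sym (opposite-involutive _)) (cong opposite (≡.sym eq)))
C₄⊠P N .irrefl (v≢v , _) = v≢v refl

corner : Bool → Bool → Fin 4
corner false false = 0F
corner true  false = 1F
corner true  true  = 2F
corner false true  = 3F

corner-cross : ∀ p s t → corner (not p) t ≢ opposite (corner p s)
corner-cross false false false ()
corner-cross false false true  ()
corner-cross false true  false ()
corner-cross false true  true  ()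
corner-cross true  false false ()
corner-cross true  false true  ()
corner-cross true  true  false ()
corner-cross true  true  true  ()

corner-along : ∀ p s → corner p s ≢ opposite (corner p s)
corner-along false false ()
corner-along false true  ()
corner-along true  false ()
corner-along true  true  ()

corner-opp : ∀ p s → corner p (not s) ≡ opposite (corner p s)
corner-opp false false = refl
corner-opp false true  = refl
corner-opp true  false = refl
corner-opp true  true  = refl

module _ (N : ℕ) where

  -- meaningful for i ≤ N only
  vertex : Bool → Bool → ℕ → Fin (suc N * 4)
  vertex p s i = combine (i mod suc N) (corner p s)

  layer-vertex : ∀ p s {i} → i ≤ N → toℕ (quotient {suc N} 4 (vertex p s i)) ≡ i
  layer-vertex p s {i} i≤N = begin
    toℕ (quotient {suc N} 4 (vertex p s i)) ≡⟨ cong (toℕ ∘ proj₁) (remQuot-combine {suc N} (i mod suc N) (corner p s)) ⟩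
    toℕ (i mod suc N)                       ≡⟨ toℕ-fromℕ< _ ⟩
    i % suc N                               ≡⟨ m≤n⇒m%n≡m i≤N ⟩
    i                                       ∎
    where open ≡.≡-Reasoning

  side-vertex : ∀ p s i → remainder {suc N} 4 (vertex p s i) ≡ corner p s
  side-vertex p s i = cong proj₂ (remQuot-combine {suc N} (i mod suc N) (corner p s))

  vertex-injective : ∀ p s q t {i j} → i ≤ N → j ≤ N → vertex p s i ≡ vertex q t j → i ≡ j
  vertex-injective p s q t i≤N j≤N eq = ≡.trans (≡.sym (layer-vertex p s i≤N))
    (≡.trans (cong (toℕ ∘ quotient {suc N} 4) eq) (layer-vertex q t j≤N))

  opposite-distinct : ∀ p s i j → vertex p s i ≢ vertex p (not s) j
  opposite-distinct p s i j eq = corner-along p s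
    (≡.trans (≡.sym (side-vertex p s i))
      (≡.trans (cong (remainder {suc N} 4) eq) (≡.trans (side-vertex p (not s) j) (corner-opp p s))))

  opposite-nonadjacent : ∀ p s i j → ¬ Adj (C₄⊠P N) (vertex p s i) (vertex p (not s) j)
  opposite-nonadjacent p s i j (_ , _ , ¬opp) = ¬opp
    (≡.trans (side-vertex p (not s) j) (≡.trans (corner-opp p s) (cong opposite (≡.sym (side-vertex p s i)))))

  far-nonadjacent : ∀ p q s t {i} → 2 + i ≤ N → ¬ Adj (C₄⊠P N) (vertex p s i) (vertex q t (2 + i))
  far-nonadjacent p q s t 2+i≤N (_ , (_ , le) , _)
    rewrite layer-vertex p s (<⇒≤ (<⇒≤ 2+i≤N)) | layer-vertex q t 2+i≤N = 1+n≰n le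

  module _ (I₁ I₂ : Graph (suc N * 4)) (iv₁ : IsInterval I₁) (iv₂ : IsInterval I₂)
           (iff : ∀ u v → u ≢ v → (Adj (C₄⊠P N) u v ⇔ (Adj I₁ u v × Adj I₂ u v))) where

    private
      meet : ∀ p s q t {i j} → i ≤ N → j ≤ N → Near i j → corner q t ≢ opposite (corner p s) →
             Meet (order I₁ iv₁) (order I₂ iv₂) (vertex p s i) (vertex q t j)
      meet p s q t {i} {j} i≤N j≤N near ¬opp with vertex p s i Fin.≟ vertex q t j
      -- Coinciding vertices arise from `along` with `i = j`.
      ... | yes eq rewrite eq =
        (≪-irrefl (order I₁ iv₁) {u} , ≪-irrefl (order I₁ iv₁) {u}) ,
        (≪-irrefl (order I₂ iv₂) {u} , ≪-irrefl (order I₂ iv₂) {u})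
        where u = vertex q t j
      ... | no u≢v = adjacent⇒overlapping I₁ iv₁ u≢v (proj₁ adj) , adjacent⇒overlapping I₂ iv₂ u≢v (proj₂ adj)
        where
        adj = Equivalence.to (iff _ _ u≢v)
          ( u≢v
          , subst₂ Near (≡.sym (layer-vertex p s i≤N)) (≡.sym (layer-vertex q t j≤N)) near
          , λ eq → ¬opp (≡.trans (≡.sym (side-vertex q t j)) (≡.trans eq (cong opposite (side-vertex p s i)))))

      apart : ∀ {u v} → u ≢ v → ¬ Adj (C₄⊠P N) u v → Apart (order I₁ iv₁) (order I₂ iv₂) u v
      apart {u} {v} u≢v ¬uv with separated-or-overlapping I₁ iv₁ u v | separated-or-overlapping I₂ iv₂ u v
      ... | inj₁ sep | _        = inj₁ sep
      ... | inj₂ _   | inj₁ sep = inj₂ sep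
      ... | inj₂ o₁  | inj₂ o₂  = contradiction
        (Equivalence.from (iff u v u≢v) (overlapping⇒adjacent I₁ iv₁ u≢v o₁ , overlapping⇒adjacent I₂ iv₂ u≢v o₂)) ¬uv

    representation-frames : Frames (order I₁ iv₁) (order I₂ iv₂) N vertex
    representation-frames .cross p s t i≤N j≤N near = meet p s (not p) t i≤N j≤N near (corner-cross p s t)
    representation-frames .along p s i≤N j≤N near   = meet p s p s i≤N j≤N near (corner-along p s)
    representation-frames .opp p s {i} {j} _ _      =
      apart (opposite-distinct p s i j) (opposite-nonadjacent p s i j)
    representation-frames .far p q s t {i} 2+i≤N    =
      apart (m+1+n≢m i ∘ ≡.trans (+-comm i 2) ∘ ≡.sym ∘ vertex-injective p s q t (<⇒≤ (<⇒≤ 2+i≤N)) 2+i≤N)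
            (far-nonadjacent p q s t 2+i≤N)

  boxicity-≥2 : ∀ e → BoxicityAtMost (C₄⊠P N) e → 2 ≤ e
  boxicity-≥2 0 (_ , _ , iff) = ⊥-elim (opposite-nonadjacent false false 0 0
    (Equivalence.from (iff _ _ (opposite-distinct false false 0 0)) (λ ())))
  boxicity-≥2 1 (Is , iv , iff) =
    contradiction (separated true) (first-separated⇒second-unseparated F z≤n (separated false))
    where
    X = order (Is 0F) (iv 0F)
    F : Frames X X N vertex
    -- Using the single interval graph twice makes it separate both opposite pairs of frame 0.
    F = representation-frames (Is 0F) (Is 0F) (iv 0F) (iv 0F) (λ u v u≢v → mk⇔
      (λ uv → let adj = Equivalence.to (iff u v u≢v) uv 0F in adj , adj)
      (λ { (adj , _) → Equivalence.from (iff u v u≢v) (λ { 0F → adj }) }))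
    separated : ∀ p → Separated X (vertex p false 0) (vertex p true 0)
    separated p = Sum.reduce (opp F p false z≤n z≤n)
  boxicity-≥2 (suc (suc e)) _ = s≤s (s≤s z≤n)

-- An explicit representation by two interval graphs

intervalGraph : ∀ {n} → (Fin n → ℕ) → (Fin n → ℕ) → Graph n
intervalGraph l r .Adj u v                 = u ≢ v × l u ≤ r v × l v ≤ r u
intervalGraph l r .sym (u≢v , p , q)       = u≢v ∘ ≡.sym , q , p
intervalGraph l r .irrefl (v≢v , _)        = v≢v refl

intervalGraph-isInterval : ∀ {n} (l r : Fin n → ℕ) → (∀ v → l v ≤ r v) → IsInterval (intervalGraph l r)
intervalGraph-isInterval l r l≤r = l , r , l≤r , λ u v u≢v → mk⇔ proj₂ (u≢v ,_)

module _ (N : ℕ) where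

  -- Sides 0 and 3 are the left and right sides of a square frame growing with
  -- its index i around the strip between suc N and suc (suc N).
  lower upper : Fin 4 → ℕ → ℕ
  lower 0F i = N ∸ i
  lower 1F i = N ∸ i
  lower 2F i = N ∸ i
  lower 3F i = suc (suc N) + i
  upper 0F i = suc N ∸ i
  upper 1F i = suc (suc N) + suc i
  upper 2F i = suc (suc N) + suc i
  upper 3F i = suc (suc N) + suc i

  -- Reflection in the diagonal, so that `lower` and `upper` also describe the vertical projections.
  transposed : Fin 4 → Fin 4
  transposed 0F = 1F
  transposed 1F = 0F
  transposed 2F = 3F
  transposed 3F = 2F

  private
    left≤upper : ∀ t {i j} → j ≤ suc i → N ∸ i ≤ upper t j
    left≤upper 0F j≤1+i = ∸-monoʳ-≤ (suc N) j≤1+i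
    left≤upper 1F {i} _ = ≤-trans (m∸n≤m N i) (m≤n⇒m≤o+n 2 (m≤m+n N _))
    left≤upper 2F {i} _ = ≤-trans (m∸n≤m N i) (m≤n⇒m≤o+n 2 (m≤m+n N _))
    left≤upper 3F {i} _ = ≤-trans (m∸n≤m N i) (m≤n⇒m≤o+n 2 (m≤m+n N _))

  lower≤upper : ∀ s t {i j} → t ≢ opposite s → Near i j → lower s i ≤ upper t j
  lower≤upper 0F t  ¬opp (_ , j≤1+i) = left≤upper t j≤1+i
  lower≤upper 1F t  ¬opp (_ , j≤1+i) = left≤upper t j≤1+i
  lower≤upper 2F t  ¬opp (_ , j≤1+i) = left≤upper t j≤1+i
  lower≤upper 3F 0F ¬opp _           = contradiction refl ¬opp
  lower≤upper 3F 1F ¬opp (i≤1+j , _) = +-monoʳ-≤ (suc (suc N)) i≤1+j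
  lower≤upper 3F 2F ¬opp (i≤1+j , _) = +-monoʳ-≤ (suc (suc N)) i≤1+j
  lower≤upper 3F 3F ¬opp (i≤1+j , _) = +-monoʳ-≤ (suc (suc N)) i≤1+j

  private
    right≰left : ∀ i j → ¬ suc (suc N) + i ≤ suc N ∸ j
    right≰left i j le = 1+n≰n (≤-trans (m≤m+n (suc (suc N)) i) (≤-trans le (m∸n≤m (suc N) j)))

  lower-right⁻¹ : ∀ t {i j} → lower 3F i ≤ upper t j → t ≢ 0F × i ≤ suc j
  lower-right⁻¹ 0F {i} {j} le = contradiction le (right≰left i j)
  lower-right⁻¹ 1F le = (λ ()) , +-cancelˡ-≤ (suc (suc N)) _ _ le
  lower-right⁻¹ 2F le = (λ ()) , +-cancelˡ-≤ (suc (suc N)) _ _ le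
  lower-right⁻¹ 3F le = (λ ()) , +-cancelˡ-≤ (suc (suc N)) _ _ le

  -- `N ∸ j` is `suc N ∸ suc j`, so the subtraction cancels; `i ≤ suc N` guards against truncation.
  upper-left⁻¹ : ∀ t {i j} → i ≤ suc N → lower t j ≤ upper 0F i → t ≢ 3F × i ≤ suc j
  upper-left⁻¹ 0F i≤K le = (λ ()) , ∸-cancelʳ-≤ i≤K le
  upper-left⁻¹ 1F i≤K le = (λ ()) , ∸-cancelʳ-≤ i≤K le
  upper-left⁻¹ 2F i≤K le = (λ ()) , ∸-cancelʳ-≤ i≤K le
  upper-left⁻¹ 3F {i} {j} i≤K le = contradiction le (right≰left j i)

  Overlap : Fin 4 → ℕ → Fin 4 → ℕ → Set
  Overlap s i t j = lower s i ≤ upper t j × lower t j ≤ upper s i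

  -- The useful coordinate is the one in which side `s` is thin: horizontal for left and right,
  -- vertical for bottom and top.
  overlap⁻¹ : ∀ s t {i j} → i ≤ suc N → Overlap s i t j → Overlap (transposed s) i (transposed t) j →
              t ≢ opposite s × i ≤ suc j
  overlap⁻¹ 0F t i≤K (_ , x) _ = upper-left⁻¹ t i≤K x
  overlap⁻¹ 3F t i≤K (x , _) _ = lower-right⁻¹ t x
  overlap⁻¹ 1F t i≤K _ (_ , y) = Product.map₁ (_∘ cong transposed) (upper-left⁻¹ (transposed t) i≤K y)
  overlap⁻¹ 2F t i≤K _ (y , _) = Product.map₁ (_∘ cong transposed) (lower-right⁻¹ (transposed t) y)

  transposed-¬opposite : ∀ s t → t ≢ opposite s → transposed t ≢ opposite (transposed s)
  transposed-¬opposite s t ¬opp eq = ¬opp (begin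
    t                                     ≡⟨ involutive t ⟨
    transposed (transposed t)             ≡⟨ cong transposed eq ⟩
    transposed (opposite (transposed s))  ≡⟨ commutes s ⟩
    opposite s                            ∎)
    where
    open ≡.≡-Reasoning
    involutive : ∀ s → transposed (transposed s) ≡ s
    involutive 0F = refl
    involutive 1F = refl
    involutive 2F = refl
    involutive 3F = refl
    commutes : ∀ s → transposed (opposite (transposed s)) ≡ opposite s
    commutes 0F = refl
    commutes 1F = refl
    commutes 2F = refl
    commutes 3F = refl

  private
    layer : Fin (suc N * 4) → ℕ
    layer = toℕ ∘ quotient {suc N} 4

    side : Fin (suc N * 4) → Fin 4
    side = remainder {suc N} 4

    layer≤ : ∀ u → layer u ≤ suc N
    layer≤ u = <⇒≤ (toℕ<n (quotient {suc N} 4 u))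

    turn : Fin 2 → Fin 4 → Fin 4
    turn 0F = id
    turn 1F = transposed

    turn-¬opposite : ∀ k s t → t ≢ opposite s → turn k t ≢ opposite (turn k s)
    turn-¬opposite 0F s t = id
    turn-¬opposite 1F s t = transposed-¬opposite s t

    ¬self-opposite : ∀ (s : Fin 4) → s ≢ opposite s
    ¬self-opposite 0F ()
    ¬self-opposite 1F ()
    ¬self-opposite 2F ()
    ¬self-opposite 3F ()

    l r : Fin 2 → Fin (suc N * 4) → ℕ
    l k u = lower (turn k (side u)) (layer u)
    r k u = upper (turn k (side u)) (layer u)

  boxicity-≤2 : BoxicityAtMost (C₄⊠P N) 2
  boxicity-≤2 = (λ k → intervalGraph (l k) (r k))
    , (λ k → intervalGraph-isInterval (l k) (r k)
        (λ v → lower≤upper (turn k (side v)) (turn k (side v)) (¬self-opposite _) near-refl))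
    , λ u v u≢v → mk⇔ (to u≢v) (from u≢v)
    where
    to : ∀ {u v} → u ≢ v → Adj (C₄⊠P N) u v → ∀ k → Adj (intervalGraph (l k) (r k)) u v
    to {u} {v} u≢v uv k = u≢v , le uv , le (Graph.sym (C₄⊠P N) uv)
      where
      le : ∀ {u v} → Adj (C₄⊠P N) u v → l k u ≤ r k v
      le {u} {v} (_ , near , ¬opp) =
        lower≤upper (turn k (side u)) (turn k (side v)) (turn-¬opposite k (side u) (side v) ¬opp) near

    -- Each call of `overlap⁻¹` bounds one layer by the other; both together give `Near`.
    from : ∀ {u v} → u ≢ v → (∀ k → Adj (intervalGraph (l k) (r k)) u v) → Adj (C₄⊠P N) u v
    from {u} {v} u≢v adj with overlap⁻¹ (side u) (side v) (layer≤ u) (proj₂ (adj 0F)) (proj₂ (adj 1F))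
      | overlap⁻¹ (side v) (side u) (layer≤ v) (Product.swap (proj₂ (adj 0F))) (Product.swap (proj₂ (adj 1F)))
    ... | ¬opp , i≤1+j | _ , j≤1+i = u≢v , (i≤1+j , j≤1+i) , ¬opp

  -- Vertices are numbered layer by layer: a step to the next layer costs 4, a change of side at
  -- most 3.
  bandwidth-≤7 : BandwidthAtMost (C₄⊠P N) 7
  bandwidth-≤7 = toℕ , toℕ-injective , bound
    where
    position : ∀ u → toℕ u ≡ 4 * layer u + toℕ (side u)
    position u = ≡.trans (cong toℕ (≡.sym (combine-remQuot {suc N} 4 u)))
                         (toℕ-combine (quotient {suc N} 4 u) (side u))

    one-sided : ∀ u v → layer u ≤ suc (layer v) → toℕ u ≤ toℕ v + 7
    one-sided u v le = begin
      toℕ u                             ≡⟨ position u ⟩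
      4 * layer u + toℕ (side u)        ≤⟨ +-mono-≤ (*-monoʳ-≤ 4 le) (toℕ≤pred[n] (side u)) ⟩
      4 * suc (layer v) + 3             ≡⟨ cong (_+ 3) (≡.trans (*-suc 4 (layer v)) (+-comm 4 _)) ⟩
      4 * layer v + 4 + 3               ≡⟨ +-assoc (4 * layer v) 4 3 ⟩
      4 * layer v + 7                   ≤⟨ +-monoˡ-≤ 7 (m≤m+n (4 * layer v) (toℕ (side v))) ⟩
      4 * layer v + toℕ (side v) + 7    ≡⟨ cong (_+ 7) (position v) ⟨
      toℕ v + 7                         ∎
      where open ≤-Reasoning

    bound : ∀ u v → Adj (C₄⊠P N) u v → ∣ toℕ u - toℕ v ∣ ≤ 7
    bound u v (_ , (i≤1+j , j≤1+i) , _) with ∣m-n∣≡[m∸n]∨[n∸m] (toℕ u) (toℕ v)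
    ... | inj₁ eq rewrite eq = m≤n+o⇒m∸n≤o (toℕ u) (toℕ v) (one-sided u v i≤1+j)
    ... | inj₂ eq rewrite eq = m≤n+o⇒m∸n≤o (toℕ v) (toℕ u) (one-sided v u j≤1+i)

-- Linear treewidth and the choice of the family

clique⇒treewidth : ∀ {n t} {I : Graph n} → HasClique I (suc t) → TreewidthAtLeast I t
clique⇒treewidth (f , inj , adj) H I⊆H _ = f , inj , λ i j i≢j → I⊆H _ _ (adj i j i≢j)

representation-clique : ∀ {t} → 1 ≤ t → (I₁ I₂ : Graph (suc (t * 2) * 4)) → IsInterval I₁ → IsInterval I₂ →
  (∀ u v → u ≢ v → (Adj (C₄⊠P (t * 2)) u v ⇔ (Adj I₁ u v × Adj I₂ u v))) → HasClique I₁ (suc t)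
representation-clique {t} 1≤t I₁ I₂ iv₁ iv₂ iff
  with some-axis-overlaps {t = t} 1≤t (representation-frames (t * 2) I₁ I₂ iv₁ iv₂ iff)
... | p , meets = f , f-injective , λ i j i≢j → overlapping⇒adjacent I₁ iv₁ (i≢j ∘ f-injective) (meets (bounded i) (bounded j))
  where
  bounded : ∀ (i : Fin (suc t)) → toℕ i ≤ t
  bounded = toℕ≤pred[n]

  f : Fin (suc t) → Fin (suc (t * 2) * 4)
  f i = vertex (t * 2) p false (toℕ i * 2)

  f-injective : ∀ {i j} → f i ≡ f j → i ≡ j
  f-injective {i} {j} eq = toℕ-injective (*-cancelʳ-≡ (toℕ i) (toℕ j) 2
    (vertex-injective (t * 2) p false p false (*-monoˡ-≤ 2 (bounded i)) (*-monoˡ-≤ 2 (bounded j)) eq))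

theorem3 : ∃[ b ] ∃[ κ ] ((m : ℕ) → ∃[ n ] (m ≤ n × Σ (Graph n) λ G →
    BoxicityEq G 2 × BandwidthAtMost G b ×
    ((I₁ I₂ : Graph n) → IsInterval I₁ → IsInterval I₂ →
    (∀ u v → u ≢ v → (Adj G u v ⇔ (Adj I₁ u v × Adj I₂ u v))) →
    (∃[ t ] (n ≤ suc κ * t × TreewidthAtLeast I₁ t))
    ⊎ (∃[ t ] (n ≤ suc κ * t × TreewidthAtLeast I₂ t)))))
-- With `2 * t + 1` frames of four sides and `t ≥ 1`, there are `8 * t + 4 ≤ 12 * t` vertices; hence
-- `κ = 11`.
theorem3 = 7 , 11 , λ m → let t = suc m in
  suc (t * 2) * 4 , m≤size m , C₄⊠P (t * 2) ,
  (boxicity-≤2 (t * 2) , boxicity-≥2 (t * 2)) , bandwidth-≤7 (t * 2) ,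
  λ I₁ I₂ iv₁ iv₂ iff → inj₁
    (t , size≤12t m , clique⇒treewidth {I = I₁} (representation-clique {t} (s≤s z≤n) I₁ I₂ iv₁ iv₂ iff))
  where
  m≤size : ∀ m → m ≤ suc (suc m * 2) * 4
  m≤size m = begin
    m                    ≤⟨ n≤1+n m ⟩
    suc m                ≤⟨ m≤m*n (suc m) 2 ⟩
    suc m * 2            ≤⟨ n≤1+n _ ⟩
    suc (suc m * 2)      ≤⟨ m≤m*n _ 4 ⟩
    suc (suc m * 2) * 4  ∎
    where open ≤-Reasoning

  size≤12t : ∀ m → suc (suc m * 2) * 4 ≤ 12 * suc m
  size≤12t m = begin
    suc (suc m * 2) * 4  ≤⟨ *-monoˡ-≤ 4 (+-monoˡ-≤ (suc m * 2) (s≤s (z≤n {m}))) ⟩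
    (suc m + suc m * 2) * 4  ≡⟨ cong (_* 4) (*-suc (suc m) 2) ⟨
    suc m * 3 * 4            ≡⟨ *-assoc (suc m) 3 4 ⟩
    suc m * 12               ≡⟨ *-comm (suc m) 12 ⟩
    12 * suc m               ∎
    where open ≤-Reasoning
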